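{- Let $n \ge 1$ be an integer, let $j \in \{1,\dots,2n\}$, and let $N = n^2 + j$. The continued fraction of $\sqrt{N}$ has period of length $2$ if and only if $\frac{2n}{j}$ is an integer. In that case $\sqrt{N} = [n, \overline{\tfrac{2n}{j}, 2n}]$.
   Context: The (simple) continued fraction expansion of an irrational real number $x$ is the unique infinite sequence $[a_0,a_1,a_2,\dots]$ with $a_0\in\mathbb Z$ and $a_i$ a positive integer for $i\ge 1$, such that the convergents $a_0+\cfrac{1}{a_1+\cfrac{1}{\ddots+\cfrac{1}{a_m}}}$ converge to $x$ as $m\to\infty$. The notation $[a_0,\dots,a_k,\overline{a_{k+1},\dots,a_\ell}]$ means that the block $a_{k+1},\dots,a_\ell$ is repeated infinitely many times after the preperiod $a_0,\dots,a_k$. For $N=n^2+j$ with $1\le j\le 2n$, the continued fraction of $\sqrt N$ has the form $[n,\overline{a_1,\dots,a_r,2n}]$. To say that it "has period of length $\ell$" means that it can be written in the form $[n,\overline{a_1,\dots,a_{\ell-1},2n}]$ with a repeating block of $\ell$ entries; the block is not required to be of minimal length. -}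

module Defs where

open import Data.Nat.Base as ℕ using (ℕ; zero; suc)
open import Data.Nat.DivMod using (_mod_)
open import Data.Integer.Base as ℤ using (ℤ; +_)
open import Data.Rational.Base
open import Data.Rational.Properties
open import Data.Rational.Solver using (module +-*-Solver)
open import Data.List.Base using (List; []; _∷_)
open import Data.Vec.Base using (Vec; lookup; _∷ʳ_)
open import Data.Product.Base using (_×_; _,_; proj₁; proj₂; ∃; ∃-syntax)
open import Data.Sum.Base using (_⊎_; inj₁; inj₂)
open import Function.Base using (_∘_)
open import Relation.Binary.PropositionalEquality
  using (_≡_; refl; sym; trans; cong; cong₂; subst)
open import Relation.Nullary using (¬_; yes; no)

------------------------------------------------------------------------
-- Real numbers, as (located, two-sided) Dedekind cuts

record ℝ : Set₁ where
  field
    Lower Upper : ℚ → Set   -- Lower q means q < x, Upper q means x < q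
    inhabitedˡ  : ∃ Lower
    inhabitedᵘ  : ∃ Upper
    openˡ       : ∀ {q} → Lower q → ∃[ r ] q < r × Lower r
    openᵘ       : ∀ {q} → Upper q → ∃[ r ] r < q × Upper r
    closedˡ     : ∀ {q r} → q < r → Lower r → Lower q
    closedᵘ     : ∀ {q r} → q < r → Upper q → Upper r
    disjoint    : ∀ {q} → ¬ (Lower q × Upper q)
    located     : ∀ {q r} → q < r → Lower q ⊎ Upper r

open ℝ public using (Lower; Upper)

-- The condition on s m is s m - ε < x < s m + ε, i.e. ∣ s m - x ∣ < ε.
_ConvergesTo_ : (ℕ → ℚ) → ℝ → Set
s ConvergesTo x = ∀ (ε : ℚ) → 0ℚ < ε →
  ∃[ M ] ∀ m → M ℕ.≤ m → Lower x (s m - ε) × Upper x (s m + ε)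

------------------------------------------------------------------------
-- Square roots of natural numbers

fromℕ : ℕ → ℚ
fromℕ N = + N / 1

BelowSqrt AboveSqrt : ℚ → ℚ → Set
BelowSqrt ν q = q < 0ℚ ⊎ q * q < ν
AboveSqrt ν q = 0ℚ < q × ν < q * q

private
  0<+ : ∀ {p q} → 0ℚ < p → 0ℚ ≤ q → 0ℚ < p + q
  0<+ = +-mono-<-≤

  0≤* : ∀ {p q} → 0ℚ ≤ p → 0ℚ ≤ q → 0ℚ ≤ p * q
  0≤* {p} {q} 0≤p 0≤q = subst (_≤ p * q) (*-zeroˡ q)
    (*-monoʳ-≤-nonNeg q {{nonNegative 0≤q}} 0≤p)

  0<* : ∀ {p q} → 0ℚ < p → 0ℚ < q → 0ℚ < p * q
  0<* {p} {q} 0<p 0<q = subst (_< p * q) (*-zeroˡ q)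
    (*-monoˡ-<-pos q {{positive 0<q}} 0<p)

  0<1 : 0ℚ < 1ℚ
  0<1 = positive⁻¹ 1ℚ

  ⇒0<- : ∀ {p q} → p < q → 0ℚ < q - p
  ⇒0<- {p} {q} p<q = subst (_< q - p) (+-inverseʳ p) (+-monoˡ-< (- p) p<q)

  <-by : ∀ {p q d} → 0ℚ < d → q ≡ p + d → p < q
  <-by {p} {q} {d} 0<d eq =
    subst (p <_) (sym eq) (subst (_< p + d) (+-identityʳ p) (+-monoʳ-< p 0<d))

  square-mono-≤ : ∀ {p q} → 0ℚ ≤ p → p ≤ q → p * p ≤ q * q
  square-mono-≤ {p} {q} 0≤p p≤q = ≤-trans
    (*-monoʳ-≤-nonNeg p {{nonNegative 0≤p}} p≤q)
    (*-monoˡ-≤-nonNeg q {{nonNegative (≤-trans 0≤p p≤q)}} p≤q)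

  square-mono-< : ∀ {p q} → 0ℚ ≤ p → p < q → p * p < q * q
  square-mono-< {p} {q} 0≤p p<q = ≤-<-trans
    (*-monoʳ-≤-nonNeg p {{nonNegative 0≤p}} (<⇒≤ p<q))
    (*-monoʳ-<-pos q {{positive (≤-<-trans 0≤p p<q)}} p<q)

  -- For q ≥ 0 and K = ν + 1, the point r = (K q + ν) / (q + K) lies strictly
  -- between q and √ν, since r - q = (ν - q²) / (q + K) and
  -- r² - ν = (K² - ν) (q² - ν) / (q + K)².
  module Towards (ν : ℚ) (0≤ν : 0ℚ ≤ ν) (q : ℚ) (0≤q : 0ℚ ≤ q) where
    K s : ℚ
    K = ν + 1ℚ
    s = q + K

    0<K : 0ℚ < K
    0<K = +-mono-≤-< 0≤ν 0<1

    0<s : 0ℚ < s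
    0<s = +-mono-≤-< 0≤q 0<K

    instance
      s-pos : Positive s
      s-pos = positive 0<s

      s-nonZero : NonZero s
      s-nonZero = pos⇒nonZero s

    t r : ℚ
    t = 1/ s
    r = (K * q + ν) * t

    0<t : 0ℚ < t
    0<t = positive⁻¹ t {{1/pos⇒pos s}}

    st≡1 : s * t ≡ 1ℚ
    st≡1 = *-inverseʳ s

    open +-*-Solver

    r-eq : r ≡ q + (ν - q * q) * t
    r-eq = trans
      (solve 3 (λ ν q t →
          ((ν :+ con 1ℚ) :* q :+ ν) :* t
        := q :* ((q :+ (ν :+ con 1ℚ)) :* t) :+ (ν :- q :* q) :* t)
        refl ν q t)
      (cong (_+ (ν - q * q) * t) (trans (cong (q *_) st≡1) (*-identityʳ q)))

    q-eq : q ≡ r + (q * q - ν) * t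
    q-eq = trans
      (solve 3 (λ ν q t →
          q := (q :+ (ν :- q :* q) :* t) :+ (q :* q :- ν) :* t) refl ν q t)
      (cong (_+ (q * q - ν) * t) (sym r-eq))

    c : ℚ
    c = 1ℚ + (ν + ν * ν)

    0<c : 0ℚ < c
    0<c = 0<+ 0<1 (+-mono-≤ 0≤ν (0≤* 0≤ν 0≤ν))

    ν-eq : ν ≡ r * r + c * (ν - q * q) * (t * t)
    ν-eq = trans
      (sym (trans (cong₂ (λ x y → ν * (x * y)) st≡1 st≡1) (*-identityʳ ν)))
      (solve 3 (λ ν q t →
          ν :* (((q :+ (ν :+ con 1ℚ)) :* t) :* ((q :+ (ν :+ con 1ℚ)) :* t))
        := (((ν :+ con 1ℚ) :* q :+ ν) :* t) :* (((ν :+ con 1ℚ) :* q :+ ν) :* t)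
           :+ (con 1ℚ :+ (ν :+ ν :* ν)) :* (ν :- q :* q) :* (t :* t))
        refl ν q t)

    rr-eq : r * r ≡ ν + c * (q * q - ν) * (t * t)
    rr-eq = trans
      (solve 5 (λ ν q t r c →
          r :* r := (r :* r :+ c :* (ν :- q :* q) :* (t :* t))
                    :+ c :* (q :* q :- ν) :* (t :* t)) refl ν q t r c)
      (cong (_+ c * (q * q - ν) * (t * t)) (sym ν-eq))

    up : q * q < ν → q < r × r * r < ν
    up h = <-by (0<* (⇒0<- h) 0<t) r-eq
         , <-by (0<* (0<* 0<c (⇒0<- h)) (0<* 0<t 0<t)) ν-eq

    down : 0ℚ < q → ν < q * q → r < q × AboveSqrt ν r
    down 0<q h = <-by (0<* (⇒0<- h) 0<t) q-eq
               , 0<* (0<+ (0<* 0<K 0<q) 0≤ν) 0<t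
               , <-by (0<* (0<* 0<c (⇒0<- h)) (0<* 0<t 0<t)) rr-eq

√ : ℕ → ℝ
√ N = record
  { Lower      = BelowSqrt ν
  ; Upper      = AboveSqrt ν
  ; inhabitedˡ = - 1ℚ , inj₁ (negative⁻¹ (- 1ℚ))
  ; inhabitedᵘ = ν + 1ℚ , +-mono-≤-< 0≤ν 0<1 , <-by
      (0<+ 0<1 (+-mono-≤ 0≤ν (0≤* 0≤ν 0≤ν)))
      (solve 1 (λ ν → (ν :+ con 1ℚ) :* (ν :+ con 1ℚ)
                   := ν :+ (con 1ℚ :+ (ν :+ ν :* ν))) refl ν)
  ; openˡ      = openˡ
  ; openᵘ      = λ { {q} (0<q , h) →
      Towards.r ν 0≤ν q (<⇒≤ 0<q) , Towards.down ν 0≤ν q (<⇒≤ 0<q) 0<q h }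
  ; closedˡ    = closedˡ
  ; closedᵘ    = λ { q<r (0<q , h) →
      <-trans 0<q q<r , <-trans h (square-mono-< (<⇒≤ 0<q) q<r) }
  ; disjoint   = λ { (inj₁ q<0 , 0<q , _) → <-asym q<0 0<q
                   ; (inj₂ h , _ , h′) → <-asym h h′ }
  ; located    = located
  }
  where
  open +-*-Solver

  ν : ℚ
  ν = fromℕ N

  0≤ν : 0ℚ ≤ ν
  0≤ν = nonNegative⁻¹ ν {{normalize-nonNeg N 1}}

  openˡ : ∀ {q} → BelowSqrt ν q → ∃[ r ] q < r × BelowSqrt ν r
  openˡ (inj₁ q<0) with <-dense q<0
  ... | r , q<r , r<0 = r , q<r , inj₁ r<0
  openˡ {q} (inj₂ h) with q <? 0ℚ
  ... | yes q<0 = openˡ (inj₁ q<0)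
  ... | no q≮0 = T.r , proj₁ (T.up h) , inj₂ (proj₂ (T.up h))
    where module T = Towards ν 0≤ν q (≮⇒≥ q≮0)

  closedˡ : ∀ {q r} → q < r → BelowSqrt ν r → BelowSqrt ν q
  closedˡ q<r (inj₁ r<0) = inj₁ (<-trans q<r r<0)
  closedˡ {q} q<r (inj₂ h) with q <? 0ℚ
  ... | yes q<0 = inj₁ q<0
  ... | no q≮0 = inj₂ (<-trans (square-mono-< (≮⇒≥ q≮0) q<r) h)

  located : ∀ {q r} → q < r → BelowSqrt ν q ⊎ AboveSqrt ν r
  located {q} {r} q<r with q <? 0ℚ | q * q <? ν
  ... | yes q<0 | _     = inj₁ (inj₁ q<0)
  ... | no _    | yes h = inj₁ (inj₂ h)
  ... | no q≮0  | no h  = inj₂ (≤-<-trans (≮⇒≥ q≮0) q<r ,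
                                ≤-<-trans (≮⇒≥ h) (square-mono-< (≮⇒≥ q≮0) q<r))

------------------------------------------------------------------------
-- Continued fractions

PositiveTail : (ℕ → ℤ) → Set
PositiveTail a = ∀ i → ℤ.Positive (a (suc i))

-- convergent a _ m is a₀ + 1/(a₁ + 1/(⋯ + 1/aₘ)).
convergent : (a : ℕ → ℤ) → PositiveTail a → ℕ → ℚ
convergent-pos : (a : ℕ → ℤ) (a⁺ : PositiveTail a) → ℤ.Positive (a 0) →
                 ∀ m → Positive (convergent a a⁺ m)

convergent a a⁺ zero    = a 0 / 1
convergent a a⁺ (suc m) = a 0 / 1 + 1/ rest
  where
  rest : ℚ
  rest = convergent (a ∘ suc) (a⁺ ∘ suc) m

  instance
    rest-nonZero : NonZero rest
    rest-nonZero =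
      pos⇒nonZero rest {{convergent-pos (a ∘ suc) (a⁺ ∘ suc) (a⁺ 0) m}}

convergent-pos a a⁺ a₀⁺ zero with a 0 | a₀⁺
... | + suc k | _ = normalize-pos (suc k) 1
convergent-pos a a⁺ a₀⁺ (suc m) =
  pos+pos⇒pos (a 0 / 1) {{convergent-pos a a⁺ a₀⁺ zero}}
              _         {{1/pos⇒pos rest {{rest-pos}}}}
  where
  rest : ℚ
  rest = convergent (a ∘ suc) (a⁺ ∘ suc) m

  rest-pos : Positive rest
  rest-pos = convergent-pos (a ∘ suc) (a⁺ ∘ suc) (a⁺ 0) m

record _HasContinuedFraction_ (x : ℝ) (a : ℕ → ℤ) : Set where
  field
    positive-tail : PositiveTail a
    converges     : convergent a positive-tail ConvergesTo x

cycle : ∀ {A : Set} {k} → Vec A (suc k) → ℕ → A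
cycle {k = k} block i = lookup block (i mod suc k)

-- [ a₀ ∷ ⋯ ∷ aₖ ∷ [] ,overline block ] repeats block forever after a₀, …, aₖ.
[_,overline_] : ∀ {A : Set} {k} → List A → Vec A (suc k) → ℕ → A
[ []     ,overline block ] i       = cycle block i
[ x ∷ xs ,overline block ] zero    = x
[ x ∷ xs ,overline block ] (suc i) = [ xs ,overline block ] i

-- For 1 ≤ j ≤ 2n, the continued fraction of √(n² + j) can be written as
-- [n, overline(a₁, …, a_{ℓ-1}, 2n)]; the block need not be minimal.
√[_²+_]HasPeriodOfLength : (n j ℓ : ℕ) .{{_ : ℕ.NonZero ℓ}} → Set
√[ n ²+ j ]HasPeriodOfLength ℓ = ∃[ as ]
  √ (n ℕ.^ 2 ℕ.+ j) HasContinuedFraction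
    [ + n ∷ [] ,overline _∷ʳ_ {n = ℕ.pred ℓ} as (+ (2 ℕ.* n)) ]

{-# OPTIONS --safe #-}

-- Let c be the sequence of convergents of [n, overline(b, 2n)]. Two steps of
-- the expansion act on c as the Möbius map
--   c ↦ n + (c + n) / s  with  s = b (c + n) + 1,
-- whose fixed points are the roots of b (x² - n²) = 2n. The defect
-- E = b (c² - n²) - 2n is divided by s² ≥ 4 in those two steps. If
-- b j = 2n, then E = b (c² - N), so c² tends to N. Conversely E is negative
-- at even and positive at odd indices, so convergence to √N gives
-- b j < 2n + 1 and 2n < b j + 1, hence b j = 2n.

module Submission where

open import Defs
open import Data.Nat.Base as ℕ using (ℕ; zero; suc; NonZero; s≤s; z≤n)
import Data.Nat.Properties as ℕ
open import Data.Nat.DivMod using (_/_; m≥n⇒m/n>0; m/n*n≡m)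
open import Data.Nat.Divisibility using (_∣_; divides)
open import Data.Integer.Base as ℤ using (ℤ; +_)
import Data.Integer.Properties as ℤ
open import Data.List.Base using ([]; _∷_)
open import Data.Product.Base using (_×_; _,_; proj₁; proj₂; ∃-syntax)
open import Data.Rational.Base as ℚ using (ℚ; 0ℚ; 1ℚ; mkℚ; 1/_; ∣_∣; positive; nonNegative)
import Data.Rational.Properties as ℚ
open import Data.Rational.Solver using (module +-*-Solver)
open import Data.Rational.Unnormalised.Base as ℚᵘ using (mkℚᵘ; *≡*; *<*)
import Data.Rational.Unnormalised.Properties as ℚᵘ
open import Data.Sum.Base using (inj₁; inj₂)
open import Data.Vec.Base as Vec using (Vec; []; _∷_)
open import Function.Base using (_∘_)
open import Function.Bundles using (_⇔_; mk⇔)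
open import Relation.Binary.PropositionalEquality
open import Relation.Nullary using (¬_; yes; no; contradiction)

-- Ordered field arithmetic

module _ where
  open import Data.Rational.Base using (_+_; _*_; _-_; _≤_; _<_)
  open +-*-Solver

  ≤-by : ∀ {p q} d → 0ℚ ≤ d → q ≡ p + d → p ≤ q
  ≤-by {p} {q} d 0≤d eq =
    subst (p ≤_) (sym eq) (subst (_≤ p + d) (ℚ.+-identityʳ p) (ℚ.+-monoʳ-≤ p 0≤d))

  <-by : ∀ {p q} d → 0ℚ < d → q ≡ p + d → p < q
  <-by {p} {q} d 0<d eq =
    subst (p <_) (sym eq) (subst (_< p + d) (ℚ.+-identityʳ p) (ℚ.+-monoʳ-< p 0<d))

  p≤q⇒0≤q-p : ∀ {p q} → p ≤ q → 0ℚ ≤ q - p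
  p≤q⇒0≤q-p {p} {q} p≤q = subst (_≤ q - p) (ℚ.+-inverseʳ p) (ℚ.+-monoˡ-≤ (ℚ.- p) p≤q)

  p<q⇒0<q-p : ∀ {p q} → p < q → 0ℚ < q - p
  p<q⇒0<q-p {p} {q} p<q = subst (_< q - p) (ℚ.+-inverseʳ p) (ℚ.+-monoˡ-< (ℚ.- p) p<q)

  0≤q-p⇒p≤q : ∀ {p q} → 0ℚ ≤ q - p → p ≤ q
  0≤q-p⇒p≤q {p} {q} 0≤ = ≤-by (q - p) 0≤ (solve 2 (λ p q → q := p :+ (q :- p)) refl p q)

  0≤p*q : ∀ {p q} → 0ℚ ≤ p → 0ℚ ≤ q → 0ℚ ≤ p * q
  0≤p*q {p} {q} 0≤p 0≤q = ℚ.nonNegative⁻¹ (p * q)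
    {{ℚ.nonNeg*nonNeg⇒nonNeg p {{nonNegative 0≤p}} q {{nonNegative 0≤q}}}}

  0<p*q : ∀ {p q} → 0ℚ < p → 0ℚ < q → 0ℚ < p * q
  0<p*q {p} {q} 0<p 0<q = ℚ.positive⁻¹ (p * q)
    {{ℚ.pos*pos⇒pos p {{positive 0<p}} q {{positive 0<q}}}}

  0<1 : 0ℚ < 1ℚ
  0<1 = ℚ.positive⁻¹ 1ℚ

  *-mono-≤ : ∀ {p q r s} → 0ℚ ≤ q → 0ℚ ≤ r → p ≤ q → r ≤ s → p * r ≤ q * s
  *-mono-≤ {q = q} {r} 0≤q 0≤r p≤q r≤s = ℚ.≤-trans
    (ℚ.*-monoʳ-≤-nonNeg r {{nonNegative 0≤r}} p≤q)
    (ℚ.*-monoˡ-≤-nonNeg q {{nonNegative 0≤q}} r≤s)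

  0≤p*q⇒0≤p : ∀ {p q} → 0ℚ < q → 0ℚ ≤ p * q → 0ℚ ≤ p
  0≤p*q⇒0≤p {p} {q} 0<q h = ℚ.*-cancelʳ-≤-pos q {{positive 0<q}}
    (subst (_≤ p * q) (sym (ℚ.*-zeroˡ q)) h)

  0<p*q⇒0<p : ∀ {p q} → 0ℚ < q → 0ℚ < p * q → 0ℚ < p
  0<p*q⇒0<p {p} {q} 0<q h = ℚ.*-cancelʳ-<-nonNeg q {{nonNegative (ℚ.<⇒≤ 0<q)}}
    (subst (_< p * q) (sym (ℚ.*-zeroˡ q)) h)

  p*q<0⇒p<0 : ∀ {p q} → 0ℚ < q → p * q < 0ℚ → p < 0ℚ
  p*q<0⇒p<0 {p} {q} 0<q h = ℚ.*-cancelʳ-<-nonNeg q {{nonNegative (ℚ.<⇒≤ 0<q)}}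
    (subst (p * q <_) (sym (ℚ.*-zeroˡ q)) h)

  p≤∣p∣ : ∀ p → p ≤ ∣ p ∣
  p≤∣p∣ p with ℚ.≤-total 0ℚ p
  ... | inj₁ 0≤p = ℚ.≤-reflexive (sym (ℚ.0≤p⇒∣p∣≡p 0≤p))
  ... | inj₂ p≤0 = ℚ.≤-trans p≤0 (ℚ.0≤∣p∣ p)

  -p≤∣p∣ : ∀ p → ℚ.- p ≤ ∣ p ∣
  -p≤∣p∣ p = subst (ℚ.- p ≤_) (ℚ.∣-p∣≡∣p∣ p) (p≤∣p∣ (ℚ.- p))

  ≤⇒≯ : ∀ {p q} → p ≤ q → ¬ (q < p)
  ≤⇒≯ p≤q q<p = ℚ.<-irrefl refl (ℚ.≤-<-trans p≤q q<p)

  -- The nonzero argument of `1/_` depends on the number being inverted, so plain `cong` does not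
  -- apply; being irrelevant, it leaves nothing to prove once `p` and `q` are identified.
  1/-cong : ∀ {p q} .{{_ : ℚ.NonZero p}} .{{_ : ℚ.NonZero q}} → p ≡ q → 1/ p ≡ 1/ q
  1/-cong refl = refl

-- The embedding of ℕ in ℚ

-- `fromℕ m` is normalised by a gcd that is stuck on a variable `m`; homomorphism laws are therefore
-- proved on unnormalised fractions and pulled back.
toℚᵘ-fromℕ : ∀ m → ℚ.toℚᵘ (fromℕ m) ℚᵘ.≃ mkℚᵘ (+ m) 0
toℚᵘ-fromℕ m = ℚ.toℚᵘ-fromℚᵘ (mkℚᵘ (+ m) 0)

fromℕ-+ : ∀ m n → fromℕ (m ℕ.+ n) ≡ fromℕ m ℚ.+ fromℕ n
fromℕ-+ m n = ℚ.toℚᵘ-injective (begin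
  ℚ.toℚᵘ (fromℕ (m ℕ.+ n))                    ≈⟨ toℚᵘ-fromℕ (m ℕ.+ n) ⟩
  mkℚᵘ (+ (m ℕ.+ n)) 0                        ≈⟨ *≡* (cong (ℤ._* + 1) (cong₂ ℤ._+_
                                                 (sym (ℤ.*-identityʳ (+ m))) (sym (ℤ.*-identityʳ (+ n))))) ⟩
  mkℚᵘ (+ m) 0 ℚᵘ.+ mkℚᵘ (+ n) 0            ≈⟨ ℚᵘ.+-cong (toℚᵘ-fromℕ m) (toℚᵘ-fromℕ n) ⟨
  ℚ.toℚᵘ (fromℕ m) ℚᵘ.+ ℚ.toℚᵘ (fromℕ n)    ≈⟨ ℚ.toℚᵘ-homo-+ (fromℕ m) (fromℕ n) ⟨
  ℚ.toℚᵘ (fromℕ m ℚ.+ fromℕ n)              ∎)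
  where open ℚᵘ.≃-Reasoning

fromℕ-* : ∀ m n → fromℕ (m ℕ.* n) ≡ fromℕ m ℚ.* fromℕ n
fromℕ-* m n = ℚ.toℚᵘ-injective (begin
  ℚ.toℚᵘ (fromℕ (m ℕ.* n))                    ≈⟨ toℚᵘ-fromℕ (m ℕ.* n) ⟩
  mkℚᵘ (+ (m ℕ.* n)) 0                        ≈⟨ *≡* (cong (ℤ._* + 1) (ℤ.pos-* m n)) ⟩
  mkℚᵘ (+ m) 0 ℚᵘ.* mkℚᵘ (+ n) 0            ≈⟨ ℚᵘ.*-cong (toℚᵘ-fromℕ m) (toℚᵘ-fromℕ n) ⟨
  ℚ.toℚᵘ (fromℕ m) ℚᵘ.* ℚ.toℚᵘ (fromℕ n)    ≈⟨ ℚ.toℚᵘ-homo-* (fromℕ m) (fromℕ n) ⟨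
  ℚ.toℚᵘ (fromℕ m ℚ.* fromℕ n)              ∎)
  where open ℚᵘ.≃-Reasoning

fromℕ-2* : ∀ n → fromℕ (2 ℕ.* n) ≡ fromℕ n ℚ.+ fromℕ n
fromℕ-2* n = trans (cong (λ k → fromℕ (n ℕ.+ k)) (ℕ.+-identityʳ n)) (fromℕ-+ n n)

0≤fromℕ : ∀ n → 0ℚ ℚ.≤ fromℕ n
0≤fromℕ n = ℚ.nonNegative⁻¹ (fromℕ n) {{ℚ.normalize-nonNeg n 1}}

fromℕ-mono-≤ : ∀ {m n} → m ℕ.≤ n → fromℕ m ℚ.≤ fromℕ n
fromℕ-mono-≤ {m} {n} m≤n = ≤-by (fromℕ (n ℕ.∸ m)) (0≤fromℕ (n ℕ.∸ m))
  (trans (cong fromℕ (sym (ℕ.m+[n∸m]≡n m≤n))) (fromℕ-+ m (n ℕ.∸ m)))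

1≤fromℕ : ∀ n .{{_ : NonZero n}} → 1ℚ ℚ.≤ fromℕ n
1≤fromℕ n = fromℕ-mono-≤ (ℕ.>-nonZero⁻¹ n)

fromℕ-cancel-< : ∀ {m n} → fromℕ m ℚ.< fromℕ n → m ℕ.< n
fromℕ-cancel-< {m} {n} h with m ℕ.<? n
... | yes m<n = m<n
... | no m≮n  = contradiction h (≤⇒≯ (fromℕ-mono-≤ (ℕ.≮⇒≥ m≮n)))

p<fromℕ : ∀ p → ∃[ M ] p ℚ.< fromℕ M
p<fromℕ p@(mkℚ k d _) = suc ℤ.∣ k ∣ , ℚ.toℚᵘ-cancel-< (ℚᵘ.<-respʳ-≃
  (ℚᵘ.≃-sym (toℚᵘ-fromℕ (suc ℤ.∣ k ∣))) (*<* (lemma k)))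
  where
  lemma : ∀ k → k ℤ.* + 1 ℤ.< + suc ℤ.∣ k ∣ ℤ.* + suc d
  lemma k = ℤ.≤-<-trans (ℤ.≤-reflexive (ℤ.*-identityʳ k)) (ℤ.≤-<-trans (i≤∣i∣ k)
    (ℤ.+<+ (ℕ.m≤m*n (suc ℤ.∣ k ∣) (suc d))))
    where
    i≤∣i∣ : ∀ i → i ℤ.≤ + ℤ.∣ i ∣
    i≤∣i∣ (+ _) = ℤ.≤-refl
    i≤∣i∣ (ℤ.-[1+ _ ]) = ℤ.-≤+

archimedean : ∀ p {ε} → 0ℚ ℚ.< ε → ∃[ M ] p ℚ.< ε ℚ.* fromℕ M
archimedean p {ε} 0<ε = proj₁ bound , subst (ℚ._< ε ℚ.* fromℕ (proj₁ bound)) eq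
    (ℚ.*-monoʳ-<-pos ε (proj₂ bound))
  where
  instance
    ε-pos : ℚ.Positive ε
    ε-pos = positive 0<ε
    ε-nonZero : ℚ.NonZero ε
    ε-nonZero = ℚ.pos⇒nonZero ε

  bound : ∃[ M ] p ℚ.* 1/ ε ℚ.< fromℕ M
  bound = p<fromℕ (p ℚ.* 1/ ε)

  open +-*-Solver
  eq : ε ℚ.* (p ℚ.* 1/ ε) ≡ p
  eq = trans (solve 3 (λ ε p t → ε :* (p :* t) := p :* (ε :* t)) refl ε p (1/ ε))
    (trans (cong (p ℚ.*_) (ℚ.*-inverseʳ ε)) (ℚ.*-identityʳ p))

-- Convergence to a square root

module _ where
  open import Data.Rational.Base using (_+_; _*_; _-_; _≤_; _<_)
  open +-*-Solver

  -- Since c + √N ≥ 1, the distance of c from √N is at most that of c² from N. The rate K / (m + 1)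
  -- is stated without division.
  squares⇒ConvergesTo : ∀ N (c : ℕ → ℚ) K → (∀ m → 1ℚ ≤ c m) →
    (∀ m → ∣ c m * c m - fromℕ N ∣ * fromℕ (suc m) ≤ K) → c ConvergesTo √ N
  squares⇒ConvergesTo N c K 1≤c bound ε 0<ε = M , λ m M≤m → close m (near m M≤m)
    where
    ν : ℚ
    ν = fromℕ N
    M : ℕ
    M = proj₁ (archimedean K 0<ε)

    near : ∀ m → M ℕ.≤ m → ∣ c m * c m - ν ∣ < ε
    near m M≤m = ℚ.*-cancelʳ-<-nonNeg (fromℕ (suc m)) {{nonNegative (0≤fromℕ (suc m))}}
      (ℚ.≤-<-trans (bound m) (ℚ.<-≤-trans (proj₂ (archimedean K 0<ε))
        (ℚ.*-monoˡ-≤-nonNeg ε {{nonNegative (ℚ.<⇒≤ 0<ε)}}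
          (fromℕ-mono-≤ (ℕ.m≤n⇒m≤1+n M≤m)))))

    close : ∀ m → ∣ c m * c m - ν ∣ < ε → Lower (√ N) (c m - ε) × Upper (√ N) (c m + ε)
    close m h = below , 0<c+ε , above
      where
      x : ℚ
      x = c m

      0≤x : 0ℚ ≤ x
      0≤x = ℚ.≤-trans (ℚ.<⇒≤ 0<1) (1≤c m)

      0<c+ε : 0ℚ < x + ε
      0<c+ε = ℚ.+-mono-≤-< 0≤x 0<ε

      above : ν < (x + ε) * (x + ε)
      -- Of the cross term 2εx, one half equals ε + ε(x - 1); its ε absorbs the error of x² against
      -- ν.
      above = <-by
        (((ε - (ℚ.- (x * x - ν))) + ε * (x - 1ℚ)) + (ε * x + ε * ε))
        (ℚ.+-mono-<-≤
          (ℚ.+-mono-<-≤ (p<q⇒0<q-p (ℚ.≤-<-trans (-p≤∣p∣ _) h))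
                        (0≤p*q (ℚ.<⇒≤ 0<ε) (p≤q⇒0≤q-p (1≤c m))))
          (ℚ.+-mono-≤ (0≤p*q (ℚ.<⇒≤ 0<ε) 0≤x) (0≤p*q (ℚ.<⇒≤ 0<ε) (ℚ.<⇒≤ 0<ε))))
        (solve 3 (λ x ε ν → (x :+ ε) :* (x :+ ε)
          := ν :+ (((ε :- (:- (x :* x :- ν))) :+ ε :* (x :- con 1ℚ)) :+ (ε :* x :+ ε :* ε)))
          refl x ε ν)

      below : BelowSqrt ν (x - ε)
      below with x - ε ℚ.<? 0ℚ
      ... | yes x-ε<0 = inj₁ x-ε<0
      -- Now ε ≤ x, so after one half of 2εx has absorbed the error, the other half still covers ε².
      ... | no  x-ε≮0 = inj₂ (<-by
        (((ε - (x * x - ν)) + ε * (x - 1ℚ)) + ε * (x - ε))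
        (ℚ.+-mono-<-≤
          (ℚ.+-mono-<-≤ (p<q⇒0<q-p (ℚ.≤-<-trans (p≤∣p∣ _) h))
                        (0≤p*q (ℚ.<⇒≤ 0<ε) (p≤q⇒0≤q-p (1≤c m))))
          (0≤p*q (ℚ.<⇒≤ 0<ε) (ℚ.≮⇒≥ x-ε≮0)))
        (solve 3 (λ x ε ν → ν := (x :- ε) :* (x :- ε)
          :+ (((ε :- (x :* x :- ν)) :+ ε :* (x :- con 1ℚ)) :+ ε :* (x :- ε)))
          refl x ε ν))

  module _ (n : ℚ) {x ε ν : ℚ} (0<ε : 0ℚ < ε) (x≤n+1 : x ≤ n + 1ℚ) where

    -- The constant 2n + 3 bounds 2x + ε, from x ≤ n + 1 and ε ≤ 1.
    AboveSqrt⇒ : ε ≤ 1ℚ → AboveSqrt ν (x + ε) →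
      ν < x * x + ε * (n + n + (1ℚ + 1ℚ + 1ℚ))
    AboveSqrt⇒ ε≤1 (_ , h) = ℚ.<-≤-trans h (≤-by
      (ε * ((n + 1ℚ - x) + (n + 1ℚ - x) + (1ℚ - ε)))
      (0≤p*q (ℚ.<⇒≤ 0<ε) (ℚ.+-mono-≤ (ℚ.+-mono-≤ (p≤q⇒0≤q-p x≤n+1) (p≤q⇒0≤q-p x≤n+1))
        (p≤q⇒0≤q-p ε≤1)))
      (solve 3 (λ x ε n → x :* x :+ ε :* (n :+ n :+ (con 1ℚ :+ con 1ℚ :+ con 1ℚ))
          := (x :+ ε) :* (x :+ ε) :+
             ε :* ((n :+ con 1ℚ :- x) :+ (n :+ con 1ℚ :- x) :+ (con 1ℚ :- ε)))
        refl x ε n))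

    -- The hypothesis ε ≤ x rules out the negative branch of `BelowSqrt`, leaving an honest
    -- inequality between squares.
    BelowSqrt⇒ : ε ≤ x → BelowSqrt ν (x - ε) →
      x * x < ν + ε * (n + n + (1ℚ + 1ℚ + 1ℚ))
    BelowSqrt⇒ ε≤x (inj₁ x-ε<0) = contradiction x-ε<0 (≤⇒≯ (p≤q⇒0≤q-p ε≤x))
    BelowSqrt⇒ ε≤x (inj₂ h) = <-by
      ((ν - (x - ε) * (x - ε)) + ε * ((n + 1ℚ - x) + (n + 1ℚ - x) + (1ℚ + ε)))
      (ℚ.+-mono-<-≤ (p<q⇒0<q-p h) (0≤p*q (ℚ.<⇒≤ 0<ε)
        (ℚ.+-mono-≤ (ℚ.+-mono-≤ (p≤q⇒0≤q-p x≤n+1) (p≤q⇒0≤q-p x≤n+1))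
          (ℚ.+-mono-≤ (ℚ.<⇒≤ 0<1) (ℚ.<⇒≤ 0<ε)))))
      (solve 4 (λ x ε n ν → ν :+ ε :* (n :+ n :+ (con 1ℚ :+ con 1ℚ :+ con 1ℚ))
          := x :* x :+ ((ν :- (x :- ε) :* (x :- ε)) :+
             ε :* ((n :+ con 1ℚ :- x) :+ (n :+ con 1ℚ :- x) :+ (con 1ℚ :+ ε))))
        refl x ε n ν)

-- Orbits of the Möbius map

module Orbit
  (n b : ℚ) (1≤n : 1ℚ ℚ.≤ n) (1≤b : 1ℚ ℚ.≤ b) (c : ℕ → ℚ)
  (c₀ : c 0 ≡ n)
  (c₁ : (c 1 ℚ.- n) ℚ.* b ≡ 1ℚ)
  (step : ∀ m → (c (2 ℕ.+ m) ℚ.- n) ℚ.* (b ℚ.* (c m ℚ.+ n) ℚ.+ 1ℚ) ≡ c m ℚ.+ n)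
  where

  open import Data.Rational.Base using (_+_; _*_; _-_; _≤_; _<_)
  open +-*-Solver

  0<b : 0ℚ < b
  0<b = ℚ.<-≤-trans 0<1 1≤b

  0≤n : 0ℚ ≤ n
  0≤n = ℚ.≤-trans (ℚ.<⇒≤ 0<1) 1≤n

  s : ℕ → ℚ
  s m = b * (c m + n) + 1ℚ

  E : ℕ → ℚ
  E m = b * (c m * c m - n * n) - (n + n)

  -- Here u is c + n, and s = b u + 1 with b ≥ 1. The bound n ≤ c stays a hypothesis because the
  -- induction for `n≤c` itself uses the positivity of s at an earlier index.
  n≤c⇒u≤s : ∀ m → n ≤ c m → c m + n + 1ℚ ≤ s m
  n≤c⇒u≤s m n≤c = ≤-by ((b - 1ℚ) * (c m + n))
    (0≤p*q (p≤q⇒0≤q-p 1≤b) (ℚ.+-mono-≤ (ℚ.≤-trans 0≤n n≤c) 0≤n))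
    (solve 3 (λ b c n → b :* (c :+ n) :+ con 1ℚ
        := (c :+ n :+ con 1ℚ) :+ (b :- con 1ℚ) :* (c :+ n)) refl b (c m) n)

  n≤c⇒2≤s : ∀ m → n ≤ c m → 1ℚ + 1ℚ ≤ s m
  n≤c⇒2≤s m n≤c = ℚ.≤-trans (≤-by ((c m - 1ℚ) + n)
    (ℚ.+-mono-≤ (p≤q⇒0≤q-p (ℚ.≤-trans 1≤n n≤c)) 0≤n)
    (solve 2 (λ c n → c :+ n :+ con 1ℚ := (con 1ℚ :+ con 1ℚ) :+ ((c :- con 1ℚ) :+ n))
      refl (c m) n))
    (n≤c⇒u≤s m n≤c)

  n≤c⇒0<s : ∀ m → n ≤ c m → 0ℚ < s m
  n≤c⇒0<s m n≤c = ℚ.<-≤-trans (ℚ.positive⁻¹ (1ℚ + 1ℚ)) (n≤c⇒2≤s m n≤c)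

  0<c₁-n : 0ℚ < c 1 - n
  0<c₁-n = 0<p*q⇒0<p 0<b (subst (0ℚ <_) (sym c₁) 0<1)

  c₁-n≤1 : c 1 - n ≤ 1ℚ
  c₁-n≤1 = ℚ.*-cancelʳ-≤-pos b {{positive 0<b}}
    (subst₂ _≤_ (sym c₁) (sym (ℚ.*-identityˡ b)) 1≤b)

  n≤c : ∀ m → n ≤ c m
  n≤c 0 = ℚ.≤-reflexive (sym c₀)
  n≤c 1 = 0≤q-p⇒p≤q (ℚ.<⇒≤ 0<c₁-n)
  n≤c (suc (suc m)) = 0≤q-p⇒p≤q (0≤p*q⇒0≤p (n≤c⇒0<s m (n≤c m))
    (subst (0ℚ ≤_) (sym (step m)) (ℚ.+-mono-≤ (ℚ.≤-trans 0≤n (n≤c m)) 0≤n)))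

  2≤s : ∀ m → 1ℚ + 1ℚ ≤ s m
  2≤s m = n≤c⇒2≤s m (n≤c m)

  0<s : ∀ m → 0ℚ < s m
  0<s m = n≤c⇒0<s m (n≤c m)

  c-n≤1⇒c≤n+1 : ∀ {x} → x - n ≤ 1ℚ → x ≤ n + 1ℚ
  c-n≤1⇒c≤n+1 {x} h = subst (_≤ n + 1ℚ) (solve 2 (λ x n → n :+ (x :- n) := x) refl x n)
    (ℚ.+-monoʳ-≤ n h)

  -- From index 2 on, c exceeds n by u / s with u + 1 ≤ s. The uniform bound lets one ε, fixed
  -- before the index, serve in `ConvergesTo√⇒`.
  c≤n+1 : ∀ m → c m ≤ n + 1ℚ
  c≤n+1 0 = ≤-by 1ℚ (ℚ.<⇒≤ 0<1) (cong (_+ 1ℚ) (sym c₀))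
  c≤n+1 1 = c-n≤1⇒c≤n+1 c₁-n≤1
  c≤n+1 (suc (suc m)) = c-n≤1⇒c≤n+1 (ℚ.*-cancelʳ-≤-pos (s m) {{positive (0<s m)}}
    (subst₂ _≤_ (sym (step m)) (sym (ℚ.*-identityˡ (s m)))
      (ℚ.≤-trans (≤-by 1ℚ (ℚ.<⇒≤ 0<1) refl) (n≤c⇒u≤s m (n≤c m)))))

  -- Write x² - n² = (x - n)((x - n) + 2n) and give one factor s to each bracket: every (x - n) s
  -- becomes c + n by `step`, and a polynomial identity in b, n and c remains.
  E-step : ∀ m → E (suc (suc m)) * (s m * s m) ≡ E m
  E-step m = trans
    (solve 4 (λ b n x s →
        (b :* (x :* x :- n :* n) :- (n :+ n)) :* (s :* s)
      := b :* ((x :- n) :* s) :* ((x :- n) :* s :+ (n :+ n) :* s) :- (n :+ n) :* (s :* s))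
      refl b n (c (suc (suc m))) (s m))
    (trans
      (cong (λ u → b * u * (u + (n + n) * s m) - (n + n) * (s m * s m)) (step m))
      (solve 3 (λ b n c →
          b :* (c :+ n) :* ((c :+ n) :+ (n :+ n) :* (b :* (c :+ n) :+ con 1ℚ))
            :- (n :+ n) :* ((b :* (c :+ n) :+ con 1ℚ) :* (b :* (c :+ n) :+ con 1ℚ))
        := b :* (c :* c :- n :* n) :- (n :+ n)) refl b n (c m)))

  E₀ : E 0 ≡ ℚ.- (n + n)
  E₀ = trans (cong (λ x → b * (x * x - n * n) - (n + n)) c₀)
    (solve 2 (λ b n → b :* (n :* n :- n :* n) :- (n :+ n) := :- (n :+ n)) refl b n)

  -- As b (x - n) = 1, the term b (x² - n²) collapses to x + n.
  E₁ : E 1 ≡ c 1 - n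
  E₁ = trans
    (solve 3 (λ b n x → b :* (x :* x :- n :* n) :- (n :+ n)
      := ((x :- n) :* b) :* ((x :- n) :+ (n :+ n)) :- (n :+ n)) refl b n (c 1))
    (trans (cong (λ t → t * ((c 1 - n) + (n + n)) - (n + n)) c₁)
      (solve 2 (λ x n → con 1ℚ :* ((x :- n) :+ (n :+ n)) :- (n :+ n) := x :- n) refl (c 1) n))

  -- `E-step` only divides by a positive square, so the sign at index 0 persists at all even
  -- indices; `0<E-odd` starts likewise from index 1.
  E-even<0 : ∀ k → E (k ℕ.* 2) < 0ℚ
  E-even<0 zero = subst (_< 0ℚ) (sym E₀) (ℚ.neg-antimono-<
    (ℚ.+-mono-<-≤ (ℚ.<-≤-trans 0<1 1≤n) 0≤n))
  E-even<0 (suc k) = p*q<0⇒p<0 (0<p*q (0<s (k ℕ.* 2)) (0<s (k ℕ.* 2)))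
    (subst (_< 0ℚ) (sym (E-step (k ℕ.* 2))) (E-even<0 k))

  0<E-odd : ∀ k → 0ℚ < E (suc (k ℕ.* 2))
  0<E-odd zero = subst (0ℚ <_) (sym E₁) 0<c₁-n
  0<E-odd (suc k) = 0<p*q⇒0<p (0<p*q (0<s (suc (k ℕ.* 2))) (0<s (suc (k ℕ.* 2))))
    (subst (0ℚ <_) (sym (E-step (suc (k ℕ.* 2)))) (0<E-odd k))

  -- Because s² ≥ 4 and m + 3 ≤ 4 (m + 1), the decay of E over two steps outweighs the growth of the
  -- weight in `∣E∣-bound`.
  suc³≤s²*suc : ∀ m → fromℕ (3 ℕ.+ m) ≤ s m * s m * fromℕ (suc m)
  suc³≤s²*suc m = ℚ.≤-trans (fromℕ-mono-≤ {3 ℕ.+ m} {4 ℕ.* suc m}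
      (ℕ.≤-trans (ℕ.≤-reflexive (ℕ.+-comm 3 m)) (ℕ.≤-trans (ℕ.n≤1+n (m ℕ.+ 3)) (s≤s
        (ℕ.+-monoʳ-≤ m (ℕ.*-monoʳ-≤ 3 {1} {suc m} (s≤s z≤n)))))))
    (subst (_≤ s m * s m * fromℕ (suc m)) (sym (fromℕ-* 4 (suc m)))
      (ℚ.*-monoʳ-≤-nonNeg (fromℕ (suc m)) {{nonNegative (0≤fromℕ (suc m))}}
        (*-mono-≤ (ℚ.<⇒≤ (0<s m)) (ℚ.nonNegative⁻¹ (1ℚ + 1ℚ)) (2≤s m) (2≤s m))))

  -- E decays at least geometrically, but the rate 2n / (m + 1) suffices and avoids powers. The base
  -- cases are |E 0| = 2n and 2 |E 1| ≤ 2 ≤ 2n.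
  ∣E∣-bound : ∀ m → ∣ E m ∣ * fromℕ (suc m) ≤ n + n
  ∣E∣-bound 0 = ℚ.≤-reflexive (trans (ℚ.*-identityʳ ∣ E 0 ∣) (trans (cong ∣_∣ E₀)
    (trans (ℚ.∣-p∣≡∣p∣ (n + n)) (ℚ.0≤p⇒∣p∣≡p (ℚ.+-mono-≤ 0≤n 0≤n)))))
  ∣E∣-bound 1 = subst (λ x → x * (1ℚ + 1ℚ) ≤ n + n)
    (sym (trans (cong ∣_∣ E₁) (ℚ.0≤p⇒∣p∣≡p (ℚ.<⇒≤ 0<c₁-n))))
    (ℚ.≤-trans (ℚ.*-monoʳ-≤-nonNeg (1ℚ + 1ℚ) c₁-n≤1) (ℚ.+-mono-≤ 1≤n 1≤n))
  ∣E∣-bound (suc (suc m)) = begin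
    ∣ E″ ∣ * fromℕ (3 ℕ.+ m)
      ≤⟨ ℚ.*-monoˡ-≤-nonNeg ∣ E″ ∣ {{ℚ.∣-∣-nonNeg E″}} (suc³≤s²*suc m) ⟩
    ∣ E″ ∣ * (s m * s m * fromℕ (suc m))
      ≡⟨ ℚ.*-assoc ∣ E″ ∣ (s m * s m) (fromℕ (suc m)) ⟨
    ∣ E″ ∣ * (s m * s m) * fromℕ (suc m)
      ≡⟨ cong (λ t → ∣ E″ ∣ * t * fromℕ (suc m)) (ℚ.0≤p⇒∣p∣≡p 0≤s²) ⟨
    ∣ E″ ∣ * ∣ s m * s m ∣ * fromℕ (suc m)
      ≡⟨ cong (_* fromℕ (suc m)) (ℚ.∣p*q∣≡∣p∣*∣q∣ E″ (s m * s m)) ⟨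
    ∣ E″ * (s m * s m) ∣ * fromℕ (suc m)
      ≡⟨ cong (λ t → ∣ t ∣ * fromℕ (suc m)) (E-step m) ⟩
    ∣ E m ∣ * fromℕ (suc m)
      ≤⟨ ∣E∣-bound m ⟩
    n + n ∎
    where
    open ℚ.≤-Reasoning
    E″ : ℚ
    E″ = E (suc (suc m))

    0≤s² : 0ℚ ≤ s m * s m
    0≤s² = 0≤p*q (ℚ.<⇒≤ (0<s m)) (ℚ.<⇒≤ (0<s m))

  1≤c : ∀ m → 1ℚ ≤ c m
  1≤c m = ℚ.≤-trans 1≤n (n≤c m)

  ConvergesTo√ : ∀ N j → fromℕ N ≡ n * n + j → b * j ≡ n + n → c ConvergesTo √ N
  ConvergesTo√ N j N≡n²+j bj≡2n = squares⇒ConvergesTo N c (n + n) 1≤c λ m → ℚ.≤-trans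
    (ℚ.*-monoʳ-≤-nonNeg (fromℕ (suc m)) {{nonNegative (0≤fromℕ (suc m))}} (∣D∣≤∣E∣ m))
    (∣E∣-bound m)
    where
    E≡bD : ∀ m → E m ≡ b * (c m * c m - fromℕ N)
    E≡bD m = trans (cong (λ t → b * (c m * c m - n * n) - t) (sym bj≡2n)) (trans
      (solve 4 (λ b x n j → b :* (x :* x :- n :* n) :- b :* j
        := b :* (x :* x :- (n :* n :+ j))) refl b (c m) n j)
      (cong (λ t → b * (c m * c m - t)) (sym N≡n²+j)))

    ∣D∣≤∣E∣ : ∀ m → ∣ c m * c m - fromℕ N ∣ ≤ ∣ E m ∣
    ∣D∣≤∣E∣ m = subst₂ _≤_ (ℚ.*-identityˡ ∣ D ∣)
      (sym (trans (cong ∣_∣ (E≡bD m)) (trans (ℚ.∣p*q∣≡∣p∣*∣q∣ b D)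
        (cong (_* ∣ D ∣) (ℚ.0≤p⇒∣p∣≡p (ℚ.<⇒≤ 0<b))))))
      (ℚ.*-monoʳ-≤-nonNeg ∣ D ∣ {{ℚ.∣-∣-nonNeg D}} 1≤b)
      where
      D : ℚ
      D = c m * c m - fromℕ N

  -- A slack of 1 is enough: it forces equality once b j and 2n are natural numbers. So a single ε
  -- and one late index of each parity are inspected.
  ConvergesTo√⇒ : ∀ N j → fromℕ N ≡ n * n + j → c ConvergesTo √ N →
    b * j < (n + n) + 1ℚ × n + n < b * j + 1ℚ
  ConvergesTo√⇒ N j N≡n²+j conv = upper , lower
    where
    d : ℚ
    d = n + n + (1ℚ + 1ℚ + 1ℚ)

    1≤d : 1ℚ ≤ d
    1≤d = ≤-by (n + n + (1ℚ + 1ℚ)) (ℚ.+-mono-≤ (ℚ.+-mono-≤ 0≤n 0≤n) (ℚ.nonNegative⁻¹ (1ℚ + 1ℚ)))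
      (solve 1 (λ n → n :+ n :+ (con 1ℚ :+ con 1ℚ :+ con 1ℚ)
        := con 1ℚ :+ (n :+ n :+ (con 1ℚ :+ con 1ℚ))) refl n)

    1≤bd : 1ℚ ≤ b * d
    1≤bd = *-mono-≤ (ℚ.<⇒≤ 0<b) (ℚ.<⇒≤ 0<1) 1≤b 1≤d

    instance
      bd-pos : ℚ.Positive (b * d)
      bd-pos = positive (ℚ.<-≤-trans 0<1 1≤bd)
      bd-nonZero : ℚ.NonZero (b * d)
      bd-nonZero = ℚ.pos⇒nonZero (b * d)

    -- Chosen so that the error ε d of the square estimates, multiplied by b, is exactly 1.
    ε : ℚ
    ε = 1/ (b * d)

    0<ε : 0ℚ < ε
    0<ε = ℚ.positive⁻¹ ε {{ℚ.1/pos⇒pos (b * d)}}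

    ε*bd≡1 : ε * (b * d) ≡ 1ℚ
    ε*bd≡1 = ℚ.*-inverseˡ (b * d)

    ε≤1 : ε ≤ 1ℚ
    ε≤1 = subst₂ _≤_ (ℚ.*-identityʳ ε) ε*bd≡1
      (ℚ.*-monoˡ-≤-nonNeg ε {{nonNegative (ℚ.<⇒≤ 0<ε)}} 1≤bd)

    M : ℕ
    M = proj₁ (conv ε 0<ε)

    M≤M*2 : M ℕ.≤ M ℕ.* 2
    M≤M*2 = ℕ.m≤m*n M 2

    +1-eq : ∀ x → b * x + 1ℚ ≡ b * (x + ε * d)
    +1-eq x = trans (cong (λ t → b * x + t) (sym ε*bd≡1))
      (solve 4 (λ b x ε d → b :* x :+ ε :* (b :* d) := b :* (x :+ ε :* d)) refl b x ε d)

    upper : b * j < (n + n) + 1ℚ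
    -- The summands are b c² + 1 - b N, positive by convergence, and -E, positive at an even index.
    upper = <-by (((b * (x * x) + 1ℚ) - b * (n * n + j)) + (0ℚ - E k))
      (ℚ.+-mono-< (p<q⇒0<q-p h) (p<q⇒0<q-p (E-even<0 M)))
      (solve 4 (λ b n x j → (n :+ n) :+ con 1ℚ
        := b :* j :+ (((b :* (x :* x) :+ con 1ℚ) :- b :* (n :* n :+ j))
             :+ (con 0ℚ :- (b :* (x :* x :- n :* n) :- (n :+ n))))) refl b n x j)
      where
      k : ℕ
      k = M ℕ.* 2
      x : ℚ
      x = c k
      h : b * (n * n + j) < b * (x * x) + 1ℚ
      h = subst₂ _<_ (cong (b *_) N≡n²+j) (sym (+1-eq (x * x)))
        (ℚ.*-monoʳ-<-pos b {{positive 0<b}}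
          (AboveSqrt⇒ n 0<ε (c≤n+1 k) ε≤1 (proj₂ (proj₂ (conv ε 0<ε) k M≤M*2))))

    lower : n + n < b * j + 1ℚ
    -- The mirror image at an odd index, where E itself is positive.
    lower = <-by (((b * (n * n + j) + 1ℚ) - b * (x * x)) + E k)
      (ℚ.+-mono-< (p<q⇒0<q-p h) (0<E-odd M))
      (solve 4 (λ b n x j → b :* j :+ con 1ℚ
        := (n :+ n) :+ (((b :* (n :* n :+ j) :+ con 1ℚ) :- b :* (x :* x))
             :+ (b :* (x :* x :- n :* n) :- (n :+ n)))) refl b n x j)
      where
      k : ℕ
      k = suc (M ℕ.* 2)
      x : ℚ
      x = c k
      h : b * (x * x) < b * (n * n + j) + 1ℚ
      h = subst (b * (x * x) <_)
        (trans (sym (+1-eq (fromℕ N))) (cong (λ t → b * t + 1ℚ) N≡n²+j))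
        (ℚ.*-monoʳ-<-pos b {{positive 0<b}}
          (BelowSqrt⇒ n 0<ε (c≤n+1 k) (ℚ.≤-trans ε≤1 (1≤c k))
            (proj₁ (proj₂ (conv ε 0<ε) k (ℕ.m≤n⇒m≤1+n M≤M*2)))))

open import Data.Nat.Base using (_+_; _*_; _^_; _≤_)

-- Convergents of [n, overline(b, 2n)]

-- Positivity proofs influence a convergent only through the irrelevant nonzero argument of `1/_`.
convergent-irrelevant : ∀ a (p q : PositiveTail a) m → convergent a p m ≡ convergent a q m
convergent-irrelevant a p q zero    = refl
convergent-irrelevant a p q (suc m) =
  cong (a 0 ℚ./ 1 ℚ.+_) (1/-cong {{_}} {{_}} (convergent-irrelevant (a ∘ suc) (p ∘ suc) (q ∘ suc) m))

convergent-suc : ∀ a (a⁺ : PositiveTail a) m →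
  (convergent a a⁺ (suc m) ℚ.- a 0 ℚ./ 1) ℚ.* convergent (a ∘ suc) (a⁺ ∘ suc) m ≡ 1ℚ
convergent-suc a a⁺ m = trans
  (cong (ℚ._* rest) (solve 2 (λ p q → (p :+ q) :- p := q) refl (a 0 ℚ./ 1) (1/ rest)))
  (ℚ.*-inverseˡ rest)
  where
  open +-*-Solver
  rest : ℚ
  rest = convergent (a ∘ suc) (a⁺ ∘ suc) m
  instance
    rest-nonZero : ℚ.NonZero rest
    rest-nonZero = ℚ.pos⇒nonZero rest {{convergent-pos (a ∘ suc) (a⁺ ∘ suc) (a⁺ 0) m}}

module Period₂ (n b : ℕ) .{{_ : NonZero n}} .{{_ : NonZero b}} where

  block : Vec ℤ 2
  block = + b ∷ + (2 * n) ∷ []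

  a : ℕ → ℤ
  a = [ + n ∷ [] ,overline block ]

  block-positive : ∀ i → ℤ.Positive (cycle block i)
  block-positive 0 = ℤ.positive (ℤ.+<+ (ℕ.>-nonZero⁻¹ b))
  block-positive 1 = ℤ.positive (ℤ.+<+ (ℕ.>-nonZero⁻¹ (2 * n) {{ℕ.m*n≢0 2 n}}))
  block-positive (suc (suc i)) = block-positive i

  module _ (a⁺ : PositiveTail a) where

    c : ℕ → ℚ
    c = convergent a a⁺

    -- Dropping two entries replaces the leading n by 2n and leaves the periodic remainder as it
    -- was.
    shift : ∀ m → convergent (a ∘ suc ∘ suc) (a⁺ ∘ suc ∘ suc) m ≡ c m ℚ.+ fromℕ n
    shift zero    = fromℕ-2* n
    shift (suc m) = trans
      -- The tails after one and after three entries agree definitionally, since the index modulo 2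
      -- computes; only their positivity proofs differ.
      (cong₂ ℚ._+_ (fromℕ-2* n) (1/-cong {{_}} {{_}}
        (convergent-irrelevant (a ∘ suc) (a⁺ ∘ suc ∘ suc ∘ suc) (a⁺ ∘ suc) m)))
      (solve 2 (λ n t → (n :+ n) :+ t := (n :+ t) :+ n) refl (fromℕ n) _)
      where open +-*-Solver

    -- With y = c m + n and x = b + 1/y, two steps give w = 1/x; hence b y + 1 = x y and w (x y) =
    -- y.
    step : ∀ m → (c (2 + m) ℚ.- fromℕ n) ℚ.* (fromℕ b ℚ.* (c m ℚ.+ fromℕ n) ℚ.+ 1ℚ)
                 ≡ c m ℚ.+ fromℕ n
    step m = subst (λ y → w ℚ.* (fromℕ b ℚ.* y ℚ.+ 1ℚ) ≡ y) (shift m) (begin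
      w ℚ.* (fromℕ b ℚ.* y ℚ.+ 1ℚ)
        ≡⟨ cong (λ t → w ℚ.* (fromℕ b ℚ.* y ℚ.+ t)) (convergent-suc (a ∘ suc) (a⁺ ∘ suc) m) ⟨
      w ℚ.* (fromℕ b ℚ.* y ℚ.+ (x ℚ.- fromℕ b) ℚ.* y)
        ≡⟨ solve 4 (λ w b x y → w :* (b :* y :+ (x :- b) :* y) := (w :* x) :* y) refl w (fromℕ b) x y ⟩
      (w ℚ.* x) ℚ.* y
        ≡⟨ cong (ℚ._* y) (convergent-suc a a⁺ (suc m)) ⟩
      1ℚ ℚ.* y
        ≡⟨ ℚ.*-identityˡ y ⟩
      y ∎)
      where
      open ≡-Reasoning
      open +-*-Solver
      w x y : ℚ
      w = c (2 + m) ℚ.- fromℕ n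
      x = convergent (a ∘ suc) (a⁺ ∘ suc) (suc m)
      y = convergent (a ∘ suc ∘ suc) (a⁺ ∘ suc ∘ suc) m

    open Orbit (fromℕ n) (fromℕ b) (1≤fromℕ n) (1≤fromℕ b) c refl (convergent-suc a a⁺ 0) step public
      using (ConvergesTo√; ConvergesTo√⇒)

  fromℕ-n²+j : ∀ j → fromℕ (n ^ 2 + j) ≡ fromℕ n ℚ.* fromℕ n ℚ.+ fromℕ j
  fromℕ-n²+j j = trans (fromℕ-+ (n ^ 2) j) (cong (ℚ._+ fromℕ j)
    (trans (cong (λ k → fromℕ (n * k)) (ℕ.*-identityʳ n)) (fromℕ-* n n)))

  b*j≡2n⇒HasContinuedFraction : ∀ j → b * j ≡ 2 * n → √ (n ^ 2 + j) HasContinuedFraction a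
  b*j≡2n⇒HasContinuedFraction j bj≡2n = record
    { positive-tail = block-positive
    ; converges     = ConvergesTo√ block-positive (n ^ 2 + j) (fromℕ j) (fromℕ-n²+j j)
        (trans (sym (fromℕ-* b j)) (trans (cong fromℕ bj≡2n) (fromℕ-2* n)))
    }

  HasContinuedFraction⇒b*j≡2n : ∀ j → √ (n ^ 2 + j) HasContinuedFraction a → b * j ≡ 2 * n
  HasContinuedFraction⇒b*j≡2n j cf = ℕ.≤-antisym
    (<+1⇒≤ (subst₂ (λ x y → x ℚ.< y ℚ.+ 1ℚ) (sym (fromℕ-* b j)) (sym (fromℕ-2* n)) (proj₁ bounds)))
    (<+1⇒≤ (subst₂ (λ x y → x ℚ.< y ℚ.+ 1ℚ) (sym (fromℕ-2* n)) (sym (fromℕ-* b j)) (proj₂ bounds)))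
    where
    open _HasContinuedFraction_ cf

    bounds = ConvergesTo√⇒ positive-tail (n ^ 2 + j) (fromℕ j) (fromℕ-n²+j j) converges

    <+1⇒≤ : ∀ {k l} → fromℕ k ℚ.< fromℕ l ℚ.+ 1ℚ → k ≤ l
    <+1⇒≤ {k} {l} h = ℕ.m<1+n⇒m≤n (subst (k ℕ.<_) (ℕ.+-comm l 1)
      (fromℕ-cancel-< (subst (fromℕ k ℚ.<_) (sym (fromℕ-+ l 1)) h)))

-- Period 2 and divisibility

HasPeriod₂⇒∣ : (n j : ℕ) .{{_ : NonZero n}} → √[ n ²+ j ]HasPeriodOfLength 2 → j ∣ 2 * n
HasPeriod₂⇒∣ n j (+ suc k ∷ [] , cf) =
  divides (suc k) (sym (Period₂.HasContinuedFraction⇒b*j≡2n n (suc k) j cf))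
-- Entries that are zero or negative contradict positivity of the first partial quotient after n.
HasPeriod₂⇒∣ n j (+ zero ∷ [] , cf) with () ← _HasContinuedFraction_.positive-tail cf 0
HasPeriod₂⇒∣ n j (ℤ.-[1+ _ ] ∷ [] , cf) with () ← _HasContinuedFraction_.positive-tail cf 0

mainTheorem1 : (n j : ℕ) .{{_ : NonZero n}} .{{_ : NonZero j}} → j ≤ 2 * n →
    (√[ n ²+ j ]HasPeriodOfLength 2 ⇔ j ∣ 2 * n)
    × (j ∣ 2 * n →
    √ (n ^ 2 + j) HasContinuedFraction
    [ + n ∷ [] ,overline + (2 * n / j) ∷ + (2 * n) ∷ [] ])
mainTheorem1 n j j≤2n = mk⇔ (HasPeriod₂⇒∣ n j) (λ j∣2n → + (2 * n / j) ∷ [] , expansion j∣2n) , expansion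
  where
  expansion : j ∣ 2 * n → √ (n ^ 2 + j) HasContinuedFraction
    [ + n ∷ [] ,overline + (2 * n / j) ∷ + (2 * n) ∷ [] ]
  expansion j∣2n = Period₂.b*j≡2n⇒HasContinuedFraction n (2 * n / j) j (m/n*n≡m j∣2n)
    -- The bound j ≤ 2n makes the quotient 2n / j nonzero, hence an admissible partial quotient.
    where instance _ = ℕ.>-nonZero (m≥n⇒m/n>0 j≤2n)
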